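{- It is decidable, given a local rule $f:\mathcal{D}^r_\pi\to\mathcal{G}_\pi$, whether $f$ is rotation-commuting.
   Context: **Graphs.** Let $\pi=\{a,b,c\}$ (the set of ports) and let $V$ be a fixed uncountable set of possible vertex names. A graph $G$ is given by an at most countable set $V(G)\subseteq V$ of vertices and a set $E(G)$ of pairwise disjoint two-element subsets of $V(G)\times\pi$, called edges. An element $(u,p)$ of $V(G)\times\pi$ is written $u:p$; an edge $\{u:p,v:q\}$ links port $p$ of $u$ to port $q$ of $v$. The set of graphs is denoted $\mathcal{G}_\pi$. (Graphs are unlabelled here.) **Disks.** For a graph $G$, $v\in V(G)$ and an integer $r\ge 0$, $G^r_v$ denotes the disk of radius $r$ of $G$ centred at $v$: the subgraph of $G$ induced by the vertices at graph distance at most $r$ from $v$, together with the distinguished centre $v$. The set of all disks of radius $r$ is $\mathcal{D}^r_\pi$. **Isomorphisms.** A bijection $R:V\to V$ acts on graphs by renaming vertices: $V(R(G))=R(V(G))$ and $\{u:k,v:l\}\in E(G)\Leftrightarrow\{R(u):k,R(v):l\}\in E(R(G))$ (on a disk it also renames the centre). For a bound $b$, $R$ induces $R^*$ on graphs whose vertices are subsets of $V.\{\varepsilon,1,\dots,b\}$ (the set of names $u.i$ with $u\in V$, $i\in\{\varepsilon,1,\dots,b\}$) by renaming each vertex according to $R^*(\{u.i,v.j,\dots\})=\{R(u).i,R(v).j,\dots\}$. Such subsets are admitted as vertex names for graphs produced by local rules; graphs with such vertex names are still regarded as elements of $\mathcal{G}_\pi$. **Consistency.** Graphs $G,H$ are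 consistent if for all vertices $u,v,w$ and ports $k,l,p$: $\{u:k,v:l\}\in E(G)$ and $\{u:k,w:p\}\in E(H)$ imply $w=v$ and $l=p$. **Local rule.** A function $f:\mathcal{D}^r_\pi\to\mathcal{G}_\pi$ is a local rule (of radius $r$) if there is a bound $b$ such that: (i) for every disk $D$, every $v'\in V(f(D))$ satisfies $v'\subseteq V(D).\{\varepsilon,1,\dots,b\}$; (ii) for every graph $G$ and all disks $D_1,D_2$ of radius $r$ of $G$, $f(D_1)$ and $f(D_2)$ are consistent; (iii) for every disk $D$ and every bijection $R:V\to V$, $f(R(D))=R^*(f(D))$. By (iii), $f$ is determined by its values on one representative of each of the finitely many isomorphism classes of disks of radius $r$; a local rule is given as input to an algorithm by $r$, $b$ and this finite table. **Rotations.** Fix a cyclic permutation $p_{\mathrm{ports}}$ of $\{a,b,c\}$. For a graph $G$ and $u\in V(G)$, $r_uG$ is the graph with the same vertices as $G$, obtained by replacing in every edge each occurrence of $u:i$ by $u:p_{\mathrm{ports}}(i)$ and leaving everything else unchanged. A rotation sequence $\overline{r}$ is a finite composition of vertex rotations $r_{u_1},r_{u_2},\dots$. **Rotation-commuting.** A function $f$ from disks to graphs is rotation-commuting if for every disk $D$ and every rotation sequence $\overline{r}$ of vertices of $D$ there exists a rotation sequence $\overline{r}^*$ of vertices of $f(D)$ such that $f(\overline{r}D)=\overline{r}^*f(D)$. -}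

module Defs where

open import Axiom.ExcludedMiddle using (ExcludedMiddle)
open import Data.Fin.Base using (Fin)
open import Data.Fin.Subset using (Subset) renaming (_∈_ to _∈ₛ_)
open import Data.List.Base using (List; allFin; foldr; length; lookup)
open import Data.List.Relation.Unary.All using (All)
open import Data.List.Relation.Unary.Any using (Any)
open import Data.Nat.Base using (ℕ; suc)
open import Data.Nat.GeneralisedArithmetic using (fold)
open import Data.Product.Base using (Σ; ∃; ∃-syntax; _×_; _,_; proj₁; proj₂; map₁)
open import Data.Product using (∃!)
open import Data.Product.Relation.Binary.Pointwise.NonDependent using (_×ₛ_)
open import Data.Sum.Base using (_⊎_)
import Data.Vec.Base as Vec
open Vec using (Vec)
open import Function.Bundles using (Func; Injection; Inverse; _↔_; _↣_; _⇔_; mk⇔; module Equivalence)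
open import Level using (Level; _⊔_; 0ℓ; lift; lower) renaming (suc to lsuc)
open import Relation.Binary.Bundles using (Setoid)
open import Relation.Binary.Construct.On as On using ()
open import Relation.Binary.Core using (Rel)
open import Relation.Binary.Definitions using (DecidableEquality)
open import Relation.Binary.PropositionalEquality
  using (_≡_; refl; sym; trans; cong; subst; subst₂; setoid)
open import Relation.Nullary using (¬_; yes; no; contradiction)
open import Relation.Nullary.Decidable using (map′)
open import Relation.Unary using (Pred)
open import Relation.Unary.Relation.Binary.Equality using (≐-setoid)

private
  variable
    ℓ : Level

data Port : Set where
  pa pb pc : Port

Cyclic : Port ↔ Port → Set
Cyclic σ = ∀ p q → ∃[ k ] fold p (Inverse.to σ) k ≡ q

AtMostCountable : ∀ {a ℓ} → Setoid a ℓ → Set (a ⊔ ℓ)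
AtMostCountable S = Injection S (setoid ℕ)

-- Vertex names form a setoid because the names produced by local rules
-- are themselves sets, compared extensionally.  The set E(G) of
-- two-element sets {u:p , v:q} is a symmetric irreflexive relation on
-- Carrier × Port.

record Graph (S : Setoid ℓ 0ℓ) : Set (ℓ ⊔ lsuc 0ℓ) where
  open Setoid S using (Carrier; _≈_)
  open Setoid (S ×ₛ setoid Port) using () renaming (_≈_ to _≈ₚ_)
  field
    Vertex        : Pred Carrier 0ℓ
    Edge          : Rel (Carrier × Port) 0ℓ
    vertex-resp   : ∀ {u v} → u ≈ v → Vertex u → Vertex v
    edge-resp     : ∀ {x x′ y y′} → x ≈ₚ x′ → y ≈ₚ y′ → Edge x y → Edge x′ y′
    edge-sym      : ∀ {x y} → Edge x y → Edge y x
    edge-irrefl   : ∀ {x y} → Edge x y → ¬ (x ≈ₚ y)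
    edge-vertex   : ∀ {x y} → Edge x y → Vertex (proj₁ x)
    edge-disjoint : ∀ {x y z} → Edge x y → Edge x z → y ≈ₚ z
    countable     : AtMostCountable (On.setoid {B = Σ Carrier Vertex} S proj₁)

open Graph public

module _ {S : Setoid ℓ 0ℓ} where
  open Setoid S using (Carrier; _≈_) renaming
    (refl to ≈-refl; sym to ≈-sym; trans to ≈-trans)

  infix 4 _≈ᴳ_

  _≈ᴳ_ : Graph S → Graph S → Set ℓ
  G ≈ᴳ H = (∀ v → Vertex G v ⇔ Vertex H v) × (∀ x y → Edge G x y ⇔ Edge H x y)

  Consistent : Graph S → Graph S → Set ℓ
  Consistent G H = ∀ {u v w k l p} →
    Edge G (u , k) (v , l) → Edge H (u , k) (w , p) → w ≈ v × l ≡ p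

  private module ⇔ = Equivalence

  ≈ᴳ-refl : ∀ {G} → G ≈ᴳ G
  ≈ᴳ-refl = (λ _ → mk⇔ (λ p → p) (λ p → p)) , (λ _ _ → mk⇔ (λ p → p) (λ p → p))

  ≈ᴳ-sym : ∀ {G H} → G ≈ᴳ H → H ≈ᴳ G
  ≈ᴳ-sym (V , E) =
      (λ v → mk⇔ (⇔.from (V v)) (⇔.to (V v)))
    , (λ x y → mk⇔ (⇔.from (E x y)) (⇔.to (E x y)))

  ≈ᴳ-trans : ∀ {G H K} → G ≈ᴳ H → H ≈ᴳ K → G ≈ᴳ K
  ≈ᴳ-trans (V , E) (V′ , E′) =
      (λ v → mk⇔ (λ p → ⇔.to (V′ v) (⇔.to (V v) p))
                 (λ p → ⇔.from (V v) (⇔.from (V′ v) p)))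
    , (λ x y → mk⇔ (λ p → ⇔.to (E′ x y) (⇔.to (E x y) p))
                   (λ p → ⇔.from (E x y) (⇔.from (E′ x y) p)))

  -- The image R(G), computed by pulling back along the inverse of R.
  rename : Inverse S S → Graph S → Graph S
  rename R G = record
    { Vertex        = λ v → Vertex G (from v)
    ; Edge          = λ x y → Edge G (map₁ from x) (map₁ from y)
    ; vertex-resp   = λ u≈v → vertex-resp G (from-cong u≈v)
    ; edge-resp     = λ { (x≈ , p≡) (y≈ , q≡) →
                          edge-resp G (from-cong x≈ , p≡) (from-cong y≈ , q≡) }
    ; edge-sym      = edge-sym G
    ; edge-irrefl   = λ { e (x≈ , p≡) → edge-irrefl G e (from-cong x≈ , p≡) }
    ; edge-vertex   = edge-vertex G
    ; edge-disjoint = λ e e′ → map₁ from-injective (edge-disjoint G e e′)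
    ; countable     = record
      { to        = λ { (v , p) → code.to (from v , p) }
      ; cong      = λ u≈v → code.cong (from-cong u≈v)
      ; injective = λ eq → from-injective (code.injective eq)
      }
    }
    where
    open Inverse R
    module code = Injection (countable G)
    from-injective : ∀ {u v} → from u ≈ from v → u ≈ v
    from-injective {u} {v} eq =
      ≈-trans (≈-sym (strictlyInverseˡ u)) (≈-trans (to-cong eq) (strictlyInverseˡ v))

  rename-cong : ∀ R {G H} → G ≈ᴳ H → rename R G ≈ᴳ rename R H
  rename-cong R (V , E) = (λ v → V (from v)) , (λ x y → E (map₁ from x) (map₁ from y))
    where open Inverse R

  module _ (σ : Port ↔ Port) where
    private module σ = Inverse σ

    -- Rotating at u turns v:i into v:p.
    data Turns (u v : Carrier) (i p : Port) : Set where
      here  : v ≈ u     → p ≡ σ.to i → Turns u v i p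
      there : ¬ (v ≈ u) → p ≡ i      → Turns u v i p

    private
      turns-resp : ∀ {u v w i p} → v ≈ w → Turns u v i p → Turns u w i p
      turns-resp v≈w (here v≈u eq)  = here (≈-trans (≈-sym v≈w) v≈u) eq
      turns-resp v≈w (there v≉u eq) = there (λ w≈u → v≉u (≈-trans v≈w w≈u)) eq

      turns-injective : ∀ {u v i j p} → Turns u v i p → Turns u v j p → i ≡ j
      turns-injective {i = i} {j} (here _ refl) (here _ eq) =
        trans (sym (σ.strictlyInverseʳ i)) (trans (cong σ.from eq) (σ.strictlyInverseʳ j))
      turns-injective (here v≈u _)  (there v≉u _)   = contradiction v≈u v≉u
      turns-injective (there v≉u _) (here v≈u _)    = contradiction v≈u v≉u
      turns-injective (there _ refl) (there _ refl) = refl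

      turns-functional : ∀ {u v i p q} → Turns u v i p → Turns u v i q → p ≡ q
      turns-functional (here _ refl)  (here _ refl)  = refl
      turns-functional (here v≈u _)   (there v≉u _)  = contradiction v≈u v≉u
      turns-functional (there v≉u _)  (here v≈u _)   = contradiction v≈u v≉u
      turns-functional (there _ refl) (there _ refl) = refl

    rotate : Carrier → Graph S → Graph S
    rotate u G = record
      { Vertex        = Vertex G
      ; Edge          = λ { (v , p) (w , q) → ∃[ i ] ∃[ j ]
                            Edge G (v , i) (w , j) × Turns u v i p × Turns u w j q }
      ; vertex-resp   = vertex-resp G
      ; edge-resp     = λ { (v≈ , refl) (w≈ , refl) (i , j , e , s , t) →
                            i , j , edge-resp G (v≈ , refl) (w≈ , refl) e
                          , turns-resp v≈ s , turns-resp w≈ t }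
      ; edge-sym      = λ { (i , j , e , s , t) → j , i , edge-sym G e , t , s }
      ; edge-irrefl   = λ { (i , j , e , s , t) (v≈ , refl) → edge-irrefl G e
                            (v≈ , turns-injective (turns-resp v≈ s) t) }
      ; edge-vertex   = λ { (i , j , e , _) → edge-vertex G e }
      ; edge-disjoint = λ { (i , j , e , s , t) (i′ , j′ , e′ , s′ , t′) →
                            disjoint (turns-injective s s′) e e′ t t′ }
      ; countable     = countable G
      }
      where
      disjoint : ∀ {v w w′ i i′ j j′ q q′} → i ≡ i′ →
                 Edge G (v , i) (w , j) → Edge G (v , i′) (w′ , j′) →
                 Turns u w j q → Turns u w′ j′ q′ → w ≈ w′ × q ≡ q′
      disjoint refl e e′ t t′ with edge-disjoint G e e′
      ... | w≈ , refl = w≈ , turns-functional (turns-resp w≈ t) t′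

    rotate-cong : ∀ u {G H} → G ≈ᴳ H → rotate u G ≈ᴳ rotate u H
    rotate-cong u (V , E) = V , λ _ _ → mk⇔
      (λ { (i , j , e , st) → i , j , ⇔.to (E _ _) e , st })
      (λ { (i , j , e , st) → i , j , ⇔.from (E _ _) e , st })

    rotates : List Carrier → Graph S → Graph S
    rotates us G = foldr rotate G us

graphSetoid : Setoid ℓ 0ℓ → Setoid (ℓ ⊔ lsuc 0ℓ) ℓ
graphSetoid S = record
  { Carrier = Graph S
  ; _≈_ = _≈ᴳ_
  ; isEquivalence = record
    { refl  = λ {G} → ≈ᴳ-refl {G = G}
    ; sym   = λ {G} {H} → ≈ᴳ-sym {G = G} {H}
    ; trans = λ {G} {H} {K} → ≈ᴳ-trans {G = G} {H} {K}
    }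
  }

module _ {V : Set} where

  -- Within G v n w : the vertex w is at distance at most n from v in G.
  data Within (G : Graph (setoid V)) (v : V) : ℕ → Pred V 0ℓ where
    centred : ∀ {n} → Within G v n v
    step    : ∀ {n u p w q} →
              Within G v n u → Edge G (u , p) (w , q) → Within G v (suc n) w

  induced : Graph (setoid V) → Pred V 0ℓ → Graph (setoid V)
  induced G P = record
    { Vertex        = λ v → Vertex G v × P v
    ; Edge          = λ x y → Edge G x y × P (proj₁ x) × P (proj₁ y)
    ; vertex-resp   = λ { refl p → p }
    ; edge-resp     = λ { (refl , refl) (refl , refl) e → e }
    ; edge-sym      = λ { (e , p , q) → edge-sym G e , q , p }
    ; edge-irrefl   = λ { (e , _) → edge-irrefl G e }
    ; edge-vertex   = λ { (e , p , _) → edge-vertex G e , p }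
    ; edge-disjoint = λ { (e , _) (e′ , _) → edge-disjoint G e e′ }
    ; countable     = record
      { to        = λ { (v , p , _) → code.to (v , p) }
      ; cong      = λ eq → code.cong eq
      ; injective = λ eq → code.injective eq
      }
    }
    where module code = Injection (countable G)

  ball : Graph (setoid V) → V → ℕ → Graph (setoid V)
  ball G v r = induced G (Within G v r)

record Disk (V : Set) (r : ℕ) : Set₁ where
  field
    graph  : Graph (setoid V)
    centre : V
    isDisk : ∃[ G ] Vertex G centre × graph ≈ᴳ ball G centre r

open Disk public

diskAt : ∀ {V} (G : Graph (setoid V)) r v → Vertex G v → Disk V r
diskAt G r v v∈G = record
  { graph = ball G v r ; centre = v
  ; isDisk = G , v∈G , ≈ᴳ-refl {G = ball G v r} }

diskSetoid : Set → ℕ → Setoid (lsuc 0ℓ) 0ℓ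
diskSetoid V r = record
  { Carrier = Disk V r
  ; _≈_ = λ D D′ → graph D ≈ᴳ graph D′ × centre D ≡ centre D′
  ; isEquivalence = record
    { refl  = λ {D} → ≈ᴳ-refl {G = graph D} , refl
    ; sym   = λ { {D} {D′} (g , eq) → ≈ᴳ-sym {G = graph D} {graph D′} g , sym eq }
    ; trans = λ { {D} {D′} {D″} (g , eq) (g′ , eq′) →
                  ≈ᴳ-trans {G = graph D} {graph D′} {graph D″} g g′ , trans eq eq′ }
    }
  }

infix 4 _≈ᴰ_

_≈ᴰ_ : ∀ {V r} → Disk V r → Disk V r → Set
_≈ᴰ_ {V} {r} = Setoid._≈_ (diskSetoid V r)

module _ {V : Set} (R : V ↔ V) where
  open Inverse R

  private
    within-rename : ∀ {G v n w} → Within G v n w → Within (rename R G) (to v) n (to w)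
    within-rename centred = centred
    within-rename {G} (step {p = p} {q = q} d e) = step (within-rename d)
      (subst₂ (λ x y → Edge G (x , p) (y , q))
        (sym (strictlyInverseʳ _)) (sym (strictlyInverseʳ _)) e)

    within-rename⁻ : ∀ {G v n w} → Within (rename R G) (to v) n w → Within G v n (from w)
    within-rename⁻ {G} {v} {n} centred =
      subst (Within G v n) (sym (strictlyInverseʳ v)) centred
    within-rename⁻ (step d e) = step (within-rename⁻ d) e

    within-rename′ : ∀ {G v n w} → Within G v n (from w) → Within (rename R G) (to v) n w
    within-rename′ {G} {v} {n} {w} d =
      subst (Within (rename R G) (to v) n) (strictlyInverseˡ w) (within-rename d)

    rename-ball : ∀ G v r → rename R (ball G v r) ≈ᴳ ball (rename R G) (to v) r
    rename-ball G v r =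
        (λ _ → mk⇔ (λ { (m , d) → m , within-rename′ d })
                   (λ { (m , d) → m , within-rename⁻ d }))
      , (λ _ _ → mk⇔ (λ { (e , d , d′) → e , within-rename′ d , within-rename′ d′ })
                     (λ { (e , d , d′) → e , within-rename⁻ d , within-rename⁻ d′ }))

  renameDisk : ∀ {r} → Disk V r → Disk V r
  renameDisk {r} D = record
    { graph  = rename R (graph D)
    ; centre = to (centre D)
    ; isDisk = renamed (isDisk D)
    }
    where
    renamed : ∃[ G ] Vertex G (centre D) × graph D ≈ᴳ ball G (centre D) r →
              ∃[ G ] Vertex G (to (centre D)) ×
                     rename R (graph D) ≈ᴳ ball G (to (centre D)) r
    renamed (G , c∈G , D≈) =
        rename R G
      , subst (Vertex G) (sym (strictlyInverseʳ _)) c∈G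
      , ≈ᴳ-trans {G = rename R (graph D)} {rename R (ball G (centre D) r)}
          {ball (rename R G) (to (centre D)) r}
          (rename-cong R {graph D} {ball G (centre D) r} D≈)
          (rename-ball G (centre D) r)

infix 4 _≅_

_≅_ : ∀ {V r} → Disk V r → Disk V r → Set
_≅_ {V} D D′ = ∃[ R ] renameDisk R D ≈ᴰ D′

module _ {V : Set} (_≟_ : DecidableEquality V) (σ : Port ↔ Port) (u : V) where
  private
    turn : ∀ v i → ∃ (Turns {S = setoid V} σ u v i)
    turn v i with v ≟ u
    ... | yes v≡u = Inverse.to σ i , here v≡u refl
    ... | no  v≢u = i , there v≢u refl

    within-rotate : ∀ {G v n w} → Within G v n w → Within (rotate σ u G) v n w
    within-rotate centred = centred
    within-rotate (step d e) =
      step (within-rotate d) (_ , _ , e , proj₂ (turn _ _) , proj₂ (turn _ _))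

    within-rotate⁻ : ∀ {G v n w} → Within (rotate σ u G) v n w → Within G v n w
    within-rotate⁻ centred = centred
    within-rotate⁻ (step d (_ , _ , e , _)) = step (within-rotate⁻ d) e

    rotate-ball : ∀ G v r → rotate σ u (ball G v r) ≈ᴳ ball (rotate σ u G) v r
    rotate-ball G v r =
        (λ _ → mk⇔ (λ { (m , d) → m , within-rotate d })
                   (λ { (m , d) → m , within-rotate⁻ d }))
      , (λ _ _ → mk⇔
          (λ { (i , j , (e , d , d′) , st) →
               (i , j , e , st) , within-rotate d , within-rotate d′ })
          (λ { ((i , j , e , st) , d , d′) →
               i , j , (e , within-rotate⁻ d , within-rotate⁻ d′) , st }))

  rotateDisk : ∀ {r} → Disk V r → Disk V r
  rotateDisk {r} D = record
    { graph  = rotate σ u (graph D)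
    ; centre = centre D
    ; isDisk = rotated (isDisk D)
    }
    where
    rotated : ∃[ G ] Vertex G (centre D) × graph D ≈ᴳ ball G (centre D) r →
              ∃[ G ] Vertex G (centre D) ×
                     rotate σ u (graph D) ≈ᴳ ball G (centre D) r
    rotated (G , c∈G , D≈) =
        rotate σ u G
      , c∈G
      , ≈ᴳ-trans {G = rotate σ u (graph D)} {rotate σ u (ball G (centre D) r)}
          {ball (rotate σ u G) (centre D) r}
          (rotate-cong σ u {graph D} {ball G (centre D) r} D≈)
          (rotate-ball G (centre D) r)

rotatesDisk : ∀ {V r} → DecidableEquality V → Port ↔ Port → List V → Disk V r → Disk V r
rotatesDisk _≟_ σ us D = foldr (λ u → rotateDisk _≟_ σ u) D us

-- Suffix b is {ε, 1, …, b}, with zero standing for ε.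
Suffix : ℕ → Set
Suffix b = Fin (suc b)

Names : Set → ℕ → Setoid (lsuc 0ℓ) 0ℓ
Names V b = ≐-setoid (V × Suffix b) 0ℓ

infix 9 _*

_* : ∀ {V b} → V ↔ V → Inverse (Names V b) (Names V b)
R * = record
  { to        = λ { P (u , i) → P (from u , i) }
  ; from      = λ { P (u , i) → P (to u , i) }
  ; to-cong   = λ { (f , g) → (λ p → f p) , (λ p → g p) }
  ; from-cong = λ { (f , g) → (λ p → f p) , (λ p → g p) }
  ; inverse   =
      (λ { {P} (f , g) →
           (λ { {u , i} p → subst (λ w → P (w , i)) (strictlyInverseˡ u) (f p) })
         , (λ { {u , i} p → g (subst (λ w → P (w , i)) (sym (strictlyInverseˡ u)) p) }) })
    , (λ { {P} (f , g) →
           (λ { {u , i} p → subst (λ w → P (w , i)) (strictlyInverseʳ u) (f p) })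
         , (λ { {u , i} p → g (subst (λ w → P (w , i)) (sym (strictlyInverseʳ u)) p) }) })
  }
  where open Inverse R

record LocalRule (V : Set) (r b : ℕ) : Set₁ where
  field
    func : Func (diskSetoid V r) (graphSetoid (Names V b))
  open Func func public using () renaming (to to apply)
  field
    bounded     : ∀ D v′ → Vertex (apply D) v′ →
                  ∀ {u i} → v′ (u , i) → Vertex (graph D) u
    consistent  : ∀ G v w (v∈G : Vertex G v) (w∈G : Vertex G w) →
                  Consistent (apply (diskAt G r v v∈G)) (apply (diskAt G r w w∈G))
    equivariant : ∀ D (R : V ↔ V) → apply (renameDisk R D) ≈ᴳ rename (R *) (apply D)

open LocalRule public using (apply)

-- Classically r_u D is a disk whenever D is; seeing this requires
-- deciding which vertices are equal to u.
≟-classical : ExcludedMiddle (lsuc 0ℓ) → {V : Set} → DecidableEquality V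
≟-classical em x y = map′ lower lift em

RotationCommuting : ∀ {V r b} → ExcludedMiddle (lsuc 0ℓ) → Port ↔ Port →
                    LocalRule V r b → Set₁
RotationCommuting em σ f =
  ∀ D us → All (Vertex (graph D)) us →
  ∃[ ws ] All (Vertex (apply f D)) ws ×
          apply f (rotatesDisk (≟-classical em) σ us D) ≈ᴳ rotates σ ws (apply f D)

FinName : ℕ → ℕ → Set
FinName n b = Vec (Subset (suc b)) n

-- Input to an algorithm: a representative disk with vertices named by Fin size, and the value
-- of the rule on it.  Edges are listed in either orientation.
record Entry (b : ℕ) : Set where
  field
    size          : ℕ
    diskCentre    : Fin size
    diskEdges     : List ((Fin size × Port) × (Fin size × Port))
    valueVertices : List (FinName size b)
    valueEdges    : List ((FinName size b × Port) × (FinName size b × Port))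

Table : ℕ → Set
Table b = List (Entry b)

Lists : {S : Setoid ℓ 0ℓ} {A : Set} → (A → Setoid.Carrier S) →
        List A → List ((A × Port) × (A × Port)) → Graph S → Set ℓ
Lists {S = S} name vs es G =
    (∀ v → Vertex G v ⇔ Any (λ s → v ≈ name s) vs)
  × (∀ x y → Edge G x y ⇔ Any (λ { (s , t) →
        (x ≈ₚ map₁ name s × y ≈ₚ map₁ name t)
      ⊎ (x ≈ₚ map₁ name t × y ≈ₚ map₁ name s) }) es)
  where
  open Setoid S using (_≈_)
  open Setoid (S ×ₛ setoid Port) using () renaming (_≈_ to _≈ₚ_)

module _ {V : Set} where

  interpret : ∀ {n b} → (Fin n → V) → FinName n b → Setoid.Carrier (Names V b)
  interpret ι s (v , i) = ∃[ k ] v ≡ ι k × i ∈ₛ Vec.lookup s k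

  Records : ∀ {r b} → Entry b → Disk V r → Graph (Names V b) → Set₁
  Records {b = b} e D H = Σ (Fin size ↣ V) λ ι →
      centre D ≡ Injection.to ι diskCentre
    × Lists (Injection.to ι) (allFin size) diskEdges (graph D)
    × Lists {S = Names V b} (interpret (Injection.to ι)) valueVertices valueEdges H
    where open Entry e

  record Presents {r b} (T : Table b) (f : LocalRule V r b) : Set₁ where
    field
      representative : Fin (length T) → Disk V r
      records        : ∀ i → Records (lookup T i) (representative i)
                                     (apply f (representative i))
      complete       : ∀ D → ∃! _≡_ λ i → representative i ≅ D

-- Rotations at vertices commute and have finite order, and f is determined up to renaming by its
-- values on the representatives.  Since rotations keep the vertices of f(D), f is
-- rotation-commuting as soon as the condition holds for a rotation at one vertex of a
-- representative D.  The disk r_u D is isomorphic to a representative D′ through a bijection of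
-- finite vertex sets, which extends to V and therefore carries f(D′) to f(r_u D).  It remains to
-- search through the finitely many bijections, and through the rotation sequences of f(D) in which
-- each vertex is rotated fewer times than the order of the port permutation.

module Submission where

open import Defs
open import Axiom.ExcludedMiddle using (ExcludedMiddle)
open import Data.Bool.Base using (Bool; true)
open import Data.Bool.Properties using (T-≡) renaming (_≟_ to _≟ᵇ_)
open import Data.Fin.Base using (Fin; zero; suc; finToFun; funToFin)
import Data.Fin.Properties as Fin
open import Data.Fin.Subset using () renaming (_∈_ to _∈ₛ_)
open import Data.Fin.Subset.Properties using (⊆-antisym)
open import Data.List.Base using (List; []; _∷_; _++_; map; foldr; replicate; upTo; allFin; lookup;
  cartesianProductWith)
open import Data.List.Membership.Propositional using (_∈_; find; lose)
open import Data.List.Membership.Propositional.Properties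
  using (∈-map⁺; ∈-map⁻; ∈-++⁺ˡ; ∈-++⁺ʳ; ∈-++⁻; ∈-allFin; ∈-upTo⁺; ∈-upTo⁻;
         ∈-cartesianProductWith⁺; ∈-cartesianProductWith⁻)
open import Data.List.Properties using (foldr-++; map-cong; map-id)
import Data.List.Relation.Binary.Subset.DecPropositional as DecSubset
open import Data.List.Relation.Binary.Subset.Propositional using (_⊆_)
open import Data.List.Relation.Unary.All as All using (All; []; _∷_)
import Data.List.Relation.Unary.All.Properties as All
open import Data.List.Relation.Unary.Any using (Any; here; there; any?)
open import Data.Nat.Base using (ℕ; zero; suc; _+_; _^_; z<s)
open import Data.Nat.GeneralisedArithmetic using (fold; fold-+)
open import Data.Nat.Properties using (+-comm; m≤n⇒m<n∨m≡n)
open import Data.Product.Base as Product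
  using (Σ-syntax; ∃-syntax; ∃₂; _×_; _,_; proj₁; proj₂; map₁; map₂; swap)
open import Data.Product.Properties using (≡-dec)
open import Data.Product.Relation.Binary.Pointwise.NonDependent using (_×ₛ_)
open import Data.Sum.Base using (inj₁; inj₂)
import Data.Vec.Base as Vec
import Data.Vec.Properties as Vec
open import Function.Base using (_∘_; id)
open import Function.Bundles
  using (_↔_; _⇔_; mk⇔; mk↔ₛ′; module Func; Inverse; module Equivalence;
         module Injection)
open import Function.Construct.Composition using (_↔-∘_)
open import Function.Construct.Identity using (↔-id)
open import Function.Definitions using (Injective)
open import Function.Properties.Inverse using (↔⇒↣)
open import Level using (Level; 0ℓ) renaming (suc to lsuc)
open import Relation.Binary.Bundles using (Setoid)
open import Relation.Binary.Definitions using (DecidableEquality)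
open import Relation.Binary.PropositionalEquality
  using (_≡_; _≢_; _≗_; refl; sym; trans; cong; cong₂; subst; setoid; module ≡-Reasoning)
open import Relation.Nullary using (¬_; Dec; yes; no; contradiction)
open import Relation.Nullary.Decidable using (⌊_⌋; toWitness; fromWitness; _×-dec_)

private
  variable
    ℓ : Level
    A B : Set

-- Ports and the period of the port permutation.

_≟ᵖ_ : DecidableEquality Port
pa ≟ᵖ pa = yes refl
pa ≟ᵖ pb = no λ ()
pa ≟ᵖ pc = no λ ()
pb ≟ᵖ pa = no λ ()
pb ≟ᵖ pb = yes refl
pb ≟ᵖ pc = no λ ()
pc ≟ᵖ pa = no λ ()
pc ≟ᵖ pb = no λ ()
pc ≟ᵖ pc = yes refl

fold-suc : ∀ (f : A → A) x k → fold (f x) f k ≡ f (fold x f k)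
fold-suc f x zero    = refl
fold-suc f x (suc k) = cong f (fold-suc f x k)

fold-id : ∀ (x : A) k → fold x id k ≡ x
fold-id x zero    = refl
fold-id x (suc k) = fold-id x k

-- Written with `suc n` so that the period is positive and the exponents from 0 to `n` suffice for
-- every power.
Period : Port ↔ Port → ℕ → Set
Period σ n = ∀ p → fold p (Inverse.to σ) (suc n) ≡ p

-- Every port is an iterate of a, hence inherits the period of a.
cyclic⇒periodic : ∀ σ → Cyclic σ → ∃[ n ] Period σ n
-- Starting one step after `pa` excludes the trivial return in zero steps.
cyclic⇒periodic σ cyclic with cyclic (Inverse.to σ pa) pa
... | n , returns = n , periodic
  where
  s = Inverse.to σ
  periodic : Period σ n
  periodic p with cyclic pa p
  ... | j , refl = begin
    fold (fold pa s j) s (suc n) ≡⟨ fold-+ pa s (suc n) ⟨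
    fold pa s (suc n + j)        ≡⟨ cong (fold pa s) (+-comm (suc n) j) ⟩
    fold pa s (j + suc n)        ≡⟨ fold-+ pa s j ⟩
    fold (fold pa s (suc n)) s j ≡⟨ cong (λ q → fold q s j) fold-pa ⟩
    fold pa s j                  ∎
    where
    open ≡-Reasoning
    fold-pa : fold pa s (suc n) ≡ pa
    fold-pa = trans (sym (fold-suc s pa n)) returns

-- Finite graphs as lists.

-- Vertices and directed edges; an undirected edge is listed in both directions.
FiniteGraph : Set → Set
FiniteGraph A = List A × List ((A × Port) × (A × Port))

both : (A → B) → A × A → B × B
both f = Product.map f f

relabel : (A → B) → FiniteGraph A → FiniteGraph B
relabel g = Product.map (map g) (map (both (map₁ g)))

infix 4 _≋_

-- Mutual inclusion, because lists standing for sets may differ in order and repetition.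
_≋_ : FiniteGraph A → FiniteGraph A → Set
(vs , es) ≋ (ws , fs) = (vs ⊆ ws × ws ⊆ vs) × (es ⊆ fs × fs ⊆ es)

module _ (_≟_ : DecidableEquality A) where

  ≋-dec : (X Y : FiniteGraph A) → Dec (X ≋ Y)
  ≋-dec (vs , es) (ws , fs) =
    (vs ⊆? ws ×-dec ws ⊆? vs) ×-dec (es ⊆?ᵉ fs ×-dec fs ⊆?ᵉ es)
    where
    _≟ₚ_ = ≡-dec _≟_ _≟ᵖ_
    open DecSubset _≟_ using (_⊆?_)
    open DecSubset (≡-dec _≟ₚ_ _≟ₚ_) using () renaming (_⊆?_ to _⊆?ᵉ_)

  -- Rotation sequences on finite graphs and their normal forms.

  module _ (σ : Port ↔ Port) where

    -- The relation `Turns` as a function, available because labels have decidable equality.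
    turn : A → A → Port → Port
    turn a v p with v ≟ a
    ... | yes _ = Inverse.to σ p
    ... | no  _ = p

    turns : List A → A → Port → Port
    turns ws v p = foldr (λ a → turn a v) p ws

    -- At a fixed vertex `v` each turn is either the port permutation or the identity, and these
    -- commute.
    turn-comm : ∀ a b v p → turn a v (turn b v p) ≡ turn b v (turn a v p)
    turn-comm a b v p with v ≟ a | v ≟ b
    ... | yes _ | yes _ = refl
    ... | yes _ | no  _ = refl
    ... | no  _ | yes _ = refl
    ... | no  _ | no  _ = refl

    turn-fold-comm : ∀ a b v p k →
      fold (turn a v p) (turn b v) k ≡ turn a v (fold p (turn b v) k)
    turn-fold-comm a b v p zero    = refl
    turn-fold-comm a b v p (suc k) =
      trans (cong (turn b v) (turn-fold-comm a b v p k)) (turn-comm b a v _)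

    turns-replicate : ∀ k a ws v p →
      turns (replicate k a ++ ws) v p ≡ fold (turns ws v p) (turn a v) k
    turns-replicate zero    a ws v p = refl
    turns-replicate (suc k) a ws v p = cong (turn a v) (turns-replicate k a ws v p)

    rotatesF : List A → FiniteGraph A → FiniteGraph A
    rotatesF ws = map₂ (map (both λ (v , p) → v , turns ws v p))

    module _ (n : ℕ) (periodic : Period σ n) where

      turn-periodic : ∀ a v p → fold p (turn a v) (suc n) ≡ p
      turn-periodic a v p with v ≟ a
      ... | yes _ = periodic p
      ... | no  _ = fold-id p (suc n)

      prefix : A → ℕ → List A → List A
      prefix v k ws = replicate k v ++ ws

      -- Normal forms: one block for each listed vertex, in list order, with an exponent from 0 to
      -- `n`.
      reduced : List A → List (List A)
      reduced []       = [] ∷ []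
      reduced (v ∷ vs) =
        cartesianProductWith (prefix v) (upTo (suc n)) (reduced vs)

      reduced-⊆ : ∀ vs {ws} → ws ∈ reduced vs → All (_∈ vs) ws
      reduced-⊆ []       (here refl) = []
      reduced-⊆ (v ∷ vs) ws∈ with ∈-cartesianProductWith⁻ (prefix v) (upTo (suc n)) (reduced vs) ws∈
      ... | k , ws , _ , ws∈′ , refl =
        All.++⁺ (All.replicate⁺ k (here refl)) (All.map there (reduced-⊆ vs ws∈′))

      -- A new rotation commutes past the earlier blocks and raises the exponent of the block
      -- selected by the membership proof.
      reduce-∷ : ∀ vs {w ws} → w ∈ vs → ws ∈ reduced vs →
        ∃[ ws′ ] ws′ ∈ reduced vs × (∀ v p → turns ws′ v p ≡ turns (w ∷ ws) v p)
      reduce-∷ (u ∷ vs) w∈ ws∈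
        with ∈-cartesianProductWith⁻ (prefix u) (upTo (suc n)) (reduced vs) ws∈
      reduce-∷ (u ∷ vs) (here refl) _ | k , ws , k∈ , ws∈ , refl
        with m≤n⇒m<n∨m≡n (∈-upTo⁻ {suc n} k∈)
      ... | inj₁ k< = replicate (suc k) u ++ ws ,
        ∈-cartesianProductWith⁺ (prefix u) (∈-upTo⁺ {suc n} k<) ws∈ , λ _ _ → refl
      -- The block already holds `n` copies; one more completes the period, so the exponent drops to
      -- zero.
      ... | inj₂ k≡ = ws ,
        ∈-cartesianProductWith⁺ (prefix u) (∈-upTo⁺ {suc n} z<s) ws∈ , λ v p → sym (begin
        turn u v (turns (replicate k u ++ ws) v p) ≡⟨ cong (turn u v) (turns-replicate k u ws v p) ⟩
        fold (turns ws v p) (turn u v) (suc k)     ≡⟨ cong (fold (turns ws v p) (turn u v)) k≡ ⟩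
        fold (turns ws v p) (turn u v) (suc n) ≡⟨ turn-periodic u v _ ⟩
        turns ws v p ∎)
        where open ≡-Reasoning
      reduce-∷ (u ∷ vs) {w} (there w∈) _ | k , ws , k∈ , ws∈ , refl
        with reduce-∷ vs w∈ ws∈
      ... | ws′ , ws′∈ , eq = replicate k u ++ ws′ ,
        ∈-cartesianProductWith⁺ (prefix u) k∈ ws′∈ , λ v p → begin
          turns (replicate k u ++ ws′) v p         ≡⟨ turns-replicate k u ws′ v p ⟩
          fold (turns ws′ v p) (turn u v) k        ≡⟨ cong (λ q → fold q (turn u v) k) (eq v p) ⟩
          fold (turn w v (turns ws v p)) (turn u v) k ≡⟨ turn-fold-comm w u v _ k ⟩
          turn w v (fold (turns ws v p) (turn u v) k)
            ≡⟨ cong (turn w v) (turns-replicate k u ws v p) ⟨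
          turn w v (turns (replicate k u ++ ws) v p) ∎
        where open ≡-Reasoning

      reduce : ∀ {vs ws} → All (_∈ vs) ws →
        ∃[ ws′ ] ws′ ∈ reduced vs × (∀ v p → turns ws′ v p ≡ turns ws v p)
      reduce {vs} [] = empty vs
        where
        empty : ∀ vs → ∃[ ws′ ] ws′ ∈ reduced vs × (∀ v p → turns ws′ v p ≡ p)
        empty []       = [] , here refl , λ _ _ → refl
        empty (v ∷ vs) = let ws , ws∈ , eq = empty vs in
          ws , ∈-cartesianProductWith⁺ (prefix v) (∈-upTo⁺ {suc n} z<s) ws∈ , eq
      reduce {vs} (w∈ ∷ ws∈) with reduce ws∈
      ... | ws₁ , ws₁∈ , eq₁ with reduce-∷ vs w∈ ws₁∈
      ... | ws₂ , ws₂∈ , eq₂ = ws₂ , ws₂∈ , λ v p → trans (eq₂ v p) (cong (turn _ v) (eq₁ v p))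

-- Graphs described by finite graphs.

symmetrised : List A → List ((A × Port) × (A × Port)) → FiniteGraph A
symmetrised vs es = vs , es ++ map swap es

module _ {S : Setoid ℓ 0ℓ} where
  open Setoid S using (Carrier; _≈_) renaming (refl to ≈-refl; sym to ≈-sym; trans to ≈-trans)
  open Setoid (S ×ₛ setoid Port) using () renaming (_≈_ to _≈ₚ_; sym to ≈ₚ-sym)

  -- Unlike in `Lists`, listed edges are directed, which removes the choice of orientation. Names
  -- are compared in `S` only, and `name` may identify labels; injectivity is assumed where it
  -- matters.
  record Describes (name : A → Carrier) (X : FiniteGraph A) (G : Graph S) : Set ℓ where
    field
      vertex⁺ : ∀ {s} → s ∈ proj₁ X → Vertex G (name s)
      vertex⁻ : ∀ {v} → Vertex G v → ∃[ s ] s ∈ proj₁ X × v ≈ name s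
      edge⁺   : ∀ {s t} → (s , t) ∈ proj₂ X → Edge G (map₁ name s) (map₁ name t)
      edge⁻   : ∀ {x y} → Edge G x y →
                ∃₂ λ s t → (s , t) ∈ proj₂ X × x ≈ₚ map₁ name s × y ≈ₚ map₁ name t

  open Describes public

  lists⇒describes : ∀ {name : A → Carrier} {vs es G} →
    Lists {S = S} name vs es G → Describes name (symmetrised vs es) G
  lists⇒describes (V , E) .vertex⁺ s∈ = Equivalence.from (V _) (lose s∈ ≈-refl)
  lists⇒describes (V , E) .vertex⁻ v∈ = find (Equivalence.to (V _) v∈)
  lists⇒describes {es = es} (V , E) .edge⁺ st∈ with ∈-++⁻ es st∈
  ... | inj₁ st∈ = Equivalence.from (E _ _) (lose st∈ (inj₁ ((≈-refl , refl) , (≈-refl , refl))))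
  ... | inj₂ ts∈ with ∈-map⁻ swap ts∈
  ... | _ , ts∈ , refl =
    Equivalence.from (E _ _) (lose ts∈ (inj₂ ((≈-refl , refl) , (≈-refl , refl))))
  lists⇒describes {es = es} (V , E) .edge⁻ e with find (Equivalence.to (E _ _) e)
  ... | _ , st∈ , inj₁ (x≈ , y≈) = _ , _ , ∈-++⁺ˡ st∈ , x≈ , y≈
  ... | _ , st∈ , inj₂ (x≈ , y≈) = _ , _ , ∈-++⁺ʳ es (∈-map⁺ swap st∈) , x≈ , y≈

  module _ {name : A → Carrier} where

    describes-resp-≈ᴳ : ∀ {X G H} → G ≈ᴳ H → Describes name X G → Describes name X H
    describes-resp-≈ᴳ (V , E) d .vertex⁺ s∈ = Equivalence.to (V _) (d .vertex⁺ s∈)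
    describes-resp-≈ᴳ (V , E) d .vertex⁻ v∈ = d .vertex⁻ (Equivalence.from (V _) v∈)
    describes-resp-≈ᴳ (V , E) d .edge⁺ st∈  = Equivalence.to (E _ _) (d .edge⁺ st∈)
    describes-resp-≈ᴳ (V , E) d .edge⁻ e    = d .edge⁻ (Equivalence.from (E _ _) e)

    describes-resp-≋ : ∀ {X Y G} → X ≋ Y → Describes name X G → Describes name Y G
    describes-resp-≋ ((v⁺ , v⁻) , (e⁺ , e⁻)) d .vertex⁺ s∈ = d .vertex⁺ (v⁻ s∈)
    describes-resp-≋ ((v⁺ , v⁻) , (e⁺ , e⁻)) d .vertex⁻ v∈ = map₂ (map₁ v⁺) (d .vertex⁻ v∈)
    describes-resp-≋ ((v⁺ , v⁻) , (e⁺ , e⁻)) d .edge⁺ st∈  = d .edge⁺ (e⁻ st∈)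
    describes-resp-≋ ((v⁺ , v⁻) , (e⁺ , e⁻)) d .edge⁻ e    =
      map₂ (map₂ (map₁ e⁺)) (d .edge⁻ e)

    describes-resp-names : ∀ {name′ : A → Carrier} {X G} → (∀ s → name s ≈ name′ s) →
      Describes name X G → Describes name′ X G
    describes-resp-names {G = G} eq d .vertex⁺ s∈ = vertex-resp G (eq _) (d .vertex⁺ s∈)
    describes-resp-names eq d .vertex⁻ v∈ with d .vertex⁻ v∈
    ... | s , s∈ , v≈ = s , s∈ , ≈-trans v≈ (eq s)
    describes-resp-names {G = G} eq d .edge⁺ st∈ =
      edge-resp G (eq _ , refl) (eq _ , refl) (d .edge⁺ st∈)
    describes-resp-names eq d .edge⁻ e with d .edge⁻ e
    ... | _ , _ , st∈ , (x≈ , p≡) , (y≈ , q≡) =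
      _ , _ , st∈ , (≈-trans x≈ (eq _) , p≡) , (≈-trans y≈ (eq _) , q≡)

    vertex-describes : ∀ {X G v s} → Describes name X G → v ≈ name s → s ∈ proj₁ X → Vertex G v
    vertex-describes {G = G} d v≈ s∈ = vertex-resp G (≈-sym v≈) (d .vertex⁺ s∈)

    edge-describes : ∀ {X G x y s t} → Describes name X G →
      x ≈ₚ map₁ name s → y ≈ₚ map₁ name t → (s , t) ∈ proj₂ X → Edge G x y
    edge-describes {G = G} d x≈ y≈ st∈ = edge-resp G (≈ₚ-sym x≈) (≈ₚ-sym y≈) (d .edge⁺ st∈)

    describes-unique : ∀ {X G H} → Describes name X G → Describes name X H → G ≈ᴳ H
    describes-unique {X} d d′ =
        (λ v → mk⇔ (vertices d d′) (vertices d′ d))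
      , (λ x y → mk⇔ (edges d d′) (edges d′ d))
      where
      vertices : ∀ {G H v} → Describes name X G → Describes name X H → Vertex G v → Vertex H v
      vertices d d′ v∈ with d .vertex⁻ v∈
      ... | s , s∈ , v≈ = vertex-describes d′ v≈ s∈
      edges : ∀ {G H x y} → Describes name X G → Describes name X H → Edge G x y → Edge H x y
      edges d d′ e with d .edge⁻ e
      ... | s , t , st∈ , x≈ , y≈ = edge-describes d′ x≈ y≈ st∈

    -- Injectivity turns equality of names in `S` into equality of labels. Equality of graphs
    -- thereby becomes a comparison of lists, which is what the algorithm can test.
    describes-≋ : Injective _≡_ _≈_ name → ∀ {X Y G} →
      Describes name X G → Describes name Y G → X ≋ Y
    describes-≋ inj d d′ = (vertices d d′ , vertices d′ d) , (edges d d′ , edges d′ d)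
      where
      vertices : ∀ {X Y G} → Describes name X G → Describes name Y G → proj₁ X ⊆ proj₁ Y
      vertices d d′ s∈ with d′ .vertex⁻ (d .vertex⁺ s∈)
      ... | t , t∈ , s≈t = subst (_∈ _) (sym (inj s≈t)) t∈
      edges : ∀ {X Y G} → Describes name X G → Describes name Y G → proj₂ X ⊆ proj₂ Y
      edges d d′ st∈ with d′ .edge⁻ (d .edge⁺ st∈)
      ... | _ , _ , st∈′ , (s≈ , refl) , (t≈ , refl) with inj s≈ | inj t≈
      ... | refl | refl = st∈′

  describes-relabel : ∀ {name : B → Carrier} (g : A → B) {X G} →
    Describes (name ∘ g) X G → Describes name (relabel g X) G
  describes-relabel g d .vertex⁺ s∈ with ∈-map⁻ g s∈
  ... | _ , s∈ , refl = d .vertex⁺ s∈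
  describes-relabel g d .vertex⁻ v∈ with d .vertex⁻ v∈
  ... | s , s∈ , v≈ = g s , ∈-map⁺ g s∈ , v≈
  describes-relabel g d .edge⁺ st∈ with ∈-map⁻ (both (map₁ g)) st∈
  ... | _ , st∈ , refl = d .edge⁺ st∈
  describes-relabel g d .edge⁻ e with d .edge⁻ e
  ... | _ , _ , st∈ , x≈ , y≈ = _ , _ , ∈-map⁺ (both (map₁ g)) st∈ , x≈ , y≈

  describes-relabel⁻ : ∀ {name : B → Carrier} (g : A → B) {X G} →
    Describes name (relabel g X) G → Describes (name ∘ g) X G
  describes-relabel⁻ g d .vertex⁺ s∈ = d .vertex⁺ (∈-map⁺ g s∈)
  describes-relabel⁻ g d .vertex⁻ v∈ with d .vertex⁻ v∈
  ... | s , s∈ , v≈ with ∈-map⁻ g s∈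
  ... | s′ , s′∈ , refl = s′ , s′∈ , v≈
  describes-relabel⁻ g d .edge⁺ st∈ = d .edge⁺ (∈-map⁺ (both (map₁ g)) st∈)
  describes-relabel⁻ g d .edge⁻ e with d .edge⁻ e
  ... | _ , _ , st∈ , x≈ , y≈ with ∈-map⁻ (both (map₁ g)) st∈
  ... | _ , st∈′ , refl = _ , _ , st∈′ , x≈ , y≈

  describes-rename : ∀ (R : Inverse S S) {name : A → Carrier} {X G} →
    Describes name X G → Describes (Inverse.to R ∘ name) X (rename R G)
  describes-rename R {name} {X} {G} d = record
    { vertex⁺ = λ s∈ → vertex-resp G (≈-sym (strictlyInverseʳ _)) (d .vertex⁺ s∈)
    ; vertex⁻ = λ v∈ → map₂ (map₂ transfer) (d .vertex⁻ v∈)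
    ; edge⁺   = λ st∈ → edge-resp G (≈-sym (strictlyInverseʳ _) , refl)
                          (≈-sym (strictlyInverseʳ _) , refl) (d .edge⁺ st∈)
    ; edge⁻   = λ e → map₂ (map₂ (map₂ (Product.map (map₁ transfer) (map₁ transfer)))) (d .edge⁻ e)
    }
    where
    open Inverse R
    transfer : ∀ {v s} → from v ≈ name s → v ≈ to (name s)
    transfer eq = ≈-trans (≈-sym (strictlyInverseˡ _)) (to-cong eq)

  -- Rotations of described graphs.

  module _ (σ : Port ↔ Port) where

    Rotated : Graph S → Graph S → Set _
    Rotated G H = ∃[ ws ] All (Vertex G) ws × H ≈ᴳ rotates σ ws G

    private
      vertex-rotates⁻ : ∀ ws {G : Graph S} {v} → Vertex (rotates σ ws G) v → Vertex G v
      vertex-rotates⁻ []           v∈ = v∈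
      vertex-rotates⁻ (w ∷ ws) {G} v∈ = vertex-rotates⁻ ws {G} v∈

      rotates-cong : ∀ ws {G H : Graph S} → G ≈ᴳ H → rotates σ ws G ≈ᴳ rotates σ ws H
      rotates-cong []       eq = eq
      rotates-cong (w ∷ ws) {G} {H} eq =
        rotate-cong σ w {rotates σ ws G} {rotates σ ws H} (rotates-cong ws {G} {H} eq)

    rotated-trans : ∀ {G H K : Graph S} → Rotated G H → Rotated H K → Rotated G K
    rotated-trans {G} {H} {K} (ws , ws∈ , eq) (ws′ , ws′∈ , eq′) =
        -- `foldr` performs the last rotation of the list first, so the later sequence stands in
        -- front.
        ws′ ++ ws
      , All.++⁺ (All.map (vertex-⊆ _) ws′∈) ws∈
      , subst (K ≈ᴳ_) (sym (foldr-++ (rotate σ) G ws′ ws))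
          (≈ᴳ-trans {G = K} {rotates σ ws′ H} {rotates σ ws′ (rotates σ ws G)}
            eq′ (rotates-cong ws′ {H} {rotates σ ws G} eq))
      where
      vertex-⊆ : ∀ v → Vertex H v → Vertex G v
      vertex-⊆ v v∈ = vertex-rotates⁻ ws {G} (Equivalence.to (proj₁ eq v) v∈)

  module _ (_≟_ : DecidableEquality A) (σ : Port ↔ Port)
           {name : A → Carrier} (inj : Injective _≡_ _≈_ name) where

    private
      -- The `there` case of `Turns` requires distinct vertices; injectivity of `name` supplies this
      -- for distinct labels.
      turned : ∀ {u v a b i} → u ≈ name a → v ≈ name b → Turns {S = S} σ u v i (turn _≟_ σ a b i)
      turned {a = a} {b} u≈ v≈ with b ≟ a
      ... | yes refl = here (≈-trans v≈ (≈-sym u≈)) refl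
      ... | no  b≢a  = there (λ v≈u → b≢a (inj (≈-trans (≈-sym v≈) (≈-trans v≈u u≈)))) refl

      turned⁻ : ∀ {u v a b i p} → u ≈ name a → v ≈ name b →
        Turns {S = S} σ u v i p → p ≡ turn _≟_ σ a b i
      turned⁻ {a = a} {b} u≈ v≈ t with b ≟ a
      turned⁻ u≈ v≈ (here _ eq)     | yes _    = eq
      turned⁻ u≈ v≈ (there v≉u _)   | yes refl = contradiction (≈-trans v≈ (≈-sym u≈)) v≉u
      turned⁻ u≈ v≈ (here v≈u _)    | no b≢a   =
        contradiction (inj (≈-trans (≈-sym v≈) (≈-trans v≈u u≈))) b≢a
      turned⁻ u≈ v≈ (there _ eq)    | no _     = eq

    -- The induction step for rotation sequences. The hypothesis mentions `rotatesF` because that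
    -- function applies all of `turns` in a single map.
    describes-rotate : ∀ {u a ws X G} → u ≈ name a →
      Describes name (rotatesF _≟_ σ ws X) G →
      Describes name (rotatesF _≟_ σ (a ∷ ws) X) (rotate σ u G)
    describes-rotate u≈ d .vertex⁺ = d .vertex⁺
    describes-rotate u≈ d .vertex⁻ = d .vertex⁻
    describes-rotate {ws = ws} u≈ d .edge⁺ st∈ with ∈-map⁻ _ st∈
    ... | _ , st∈ , refl =
      _ , _ , d .edge⁺ (∈-map⁺ _ st∈) , turned u≈ ≈-refl , turned u≈ ≈-refl
    describes-rotate u≈ d .edge⁻ (i , j , e , t , t′) with d .edge⁻ e
    ... | _ , _ , st∈ , (x≈ , refl) , (y≈ , refl) with ∈-map⁻ _ st∈
    ... | _ , st∈ , refl =
      _ , _ , ∈-map⁺ _ st∈ , (x≈ , turned⁻ u≈ x≈ t) , (y≈ , turned⁻ u≈ y≈ t′)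

    describes-rotates : ∀ {ws X G} → Describes name X G →
      Describes name (rotatesF _≟_ σ ws X) (rotates σ (map name ws) G)
    describes-rotates {[]} {vs , es} {G} d =
      subst (λ fs → Describes name (vs , fs) G) (sym (map-id es)) d
    describes-rotates {w ∷ ws} d = describes-rotate {ws = ws} ≈-refl (describes-rotates {ws} d)

    -- Vertices in `us` agree with names of labels only up to the equality of `S`, so the labels
    -- have to be chosen through `vertex⁻`.
    describes-rotates⁻ : ∀ {us X G} → Describes name X G → All (Vertex G) us →
      ∃[ ws ] All (_∈ proj₁ X) ws × Describes name (rotatesF _≟_ σ ws X) (rotates σ us G)
    describes-rotates⁻ d [] = [] , [] , describes-rotates {[]} d
    describes-rotates⁻ d (u∈ ∷ us∈) with describes-rotates⁻ d us∈ | d .vertex⁻ u∈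
    ... | ws , ws∈ , d′ | s , s∈ , u≈ = s ∷ ws , s∈ ∷ ws∈ , describes-rotate {ws = ws} u≈ d′

    module _ (n : ℕ) (periodic : Period σ n) {X Y G H}
             (dG : Describes name X G) (dH : Describes name Y H) where

      -- The searchable form of `Rotated σ G H`: finitely many candidates, each tested by the
      -- decidable `_≋_`.
      Reachable : Set
      Reachable = Any (λ ws → Y ≋ rotatesF _≟_ σ ws X) (reduced _≟_ σ n periodic (proj₁ X))

      -- A given sequence is first replaced by labels and then by its normal form, which turns every
      -- port in the same way and so yields the same edge list.
      reachable⁺ : ∀ {us} → All (Vertex G) us → H ≈ᴳ rotates σ us G → Reachable
      reachable⁺ {us} us∈ H≈ with describes-rotates⁻ dG us∈
      ... | ws , ws∈ , d with reduce _≟_ σ n periodic ws∈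
      ... | ws′ , ws′∈ , eq = lose ws′∈ (subst (Y ≋_) (sym rotatesF≡) Y≋)
        where
        Y≋ : Y ≋ rotatesF _≟_ σ ws X
        Y≋ = describes-≋ inj (describes-resp-≈ᴳ {G = H} {rotates σ us G} H≈ dH) d
        rotatesF≡ : rotatesF _≟_ σ ws′ X ≡ rotatesF _≟_ σ ws X
        rotatesF≡ = cong (_ ,_) (map-cong
          (λ ((v , p) , (w , q)) → cong₂ (λ p q → (v , p) , (w , q)) (eq v p) (eq w q)) _)

      reachable⁻ : Reachable → Rotated σ G H
      reachable⁻ any with find any
      ... | ws , ws∈ , Y≋ = map name ws
        , All.map⁺ (All.map (dG .vertex⁺) (reduced-⊆ _≟_ σ n periodic _ ws∈))
        , describes-unique {G = H} {rotates σ (map name ws) G}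
            (describes-resp-≋ Y≋ dH) (describes-rotates {ws} dG)

-- Extending finite bijections to permutations of `V`.

module _ {V : Set} (_≟_ : DecidableEquality V) where

  module _ (x y : V) where

    transpose : V → V
    transpose z with z ≟ x
    ... | yes _ = y
    ... | no  _ with z ≟ y
    ... | yes _ = x
    ... | no  _ = z

    transpose-left : transpose x ≡ y
    transpose-left with x ≟ x
    ... | yes _  = refl
    ... | no x≢x = contradiction refl x≢x

    transpose-right : transpose y ≡ x
    transpose-right with y ≟ x
    ... | yes y≡x = y≡x
    ... | no  _ with y ≟ y
    ... | yes _  = refl
    ... | no y≢y = contradiction refl y≢y

    transpose-other : ∀ {z} → z ≢ x → z ≢ y → transpose z ≡ z
    transpose-other {z} z≢x z≢y with z ≟ x
    ... | yes z≡x = contradiction z≡x z≢x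
    ... | no  _ with z ≟ y
    ... | yes z≡y = contradiction z≡y z≢y
    ... | no  _   = refl

    transpose-involutive : ∀ z → transpose (transpose z) ≡ z
    transpose-involutive z with z ≟ x
    ... | yes refl = transpose-right
    ... | no  z≢x with z ≟ y
    ... | yes refl = transpose-left
    ... | no  z≢y  = transpose-other z≢x z≢y

    transposition : V ↔ V
    transposition = mk↔ₛ′ transpose transpose transpose-involutive transpose-involutive

  -- By induction, a bijection correct on all indices but `zero` is followed by the transposition
  -- that corrects `zero`. By injectivity of both families the other values avoid the two transposed
  -- points and stay fixed.
  extend-to-bijection : ∀ {n} {ι κ : Fin n → V} → Injective _≡_ _≡_ ι → Injective _≡_ _≡_ κ →
    ∃[ R ] Inverse.to {From = setoid V} {setoid V} R ∘ ι ≗ κ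
  extend-to-bijection {zero}  _ _ = ↔-id V , λ ()
  extend-to-bijection {suc n} {ι} {κ} ι-inj κ-inj
    with extend-to-bijection (Fin.suc-injective ∘ ι-inj) (Fin.suc-injective ∘ κ-inj)
  ... | R , eq = transposition a (κ zero) ↔-∘ R , extends
    where
    a = Inverse.to R (ι zero)
    extends : transpose a (κ zero) ∘ Inverse.to R ∘ ι ≗ κ
    extends zero    = transpose-left a (κ zero)
    extends (suc k) = trans (cong (transpose a (κ zero)) (eq k)) (transpose-other a (κ zero)
      (λ κ≡a → Fin.0≢1+n (sym (ι-inj (Injection.injective (↔⇒↣ R) (trans (eq k) κ≡a)))))
      (λ κ≡κ → Fin.0≢1+n (sym (κ-inj κ≡κ))))

-- Finite codes for the vertex names produced by the rule.

_≟ⁿ_ : ∀ {n b} → DecidableEquality (FinName n b)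
_≟ⁿ_ = Vec.≡-dec (Vec.≡-dec _≟ᵇ_)

-- If g and h are mutually inverse, move h renames every vertex x to g x.
move : ∀ {m n b} → (Fin n → Fin m) → FinName m b → FinName n b
move h s = Vec.tabulate (Vec.lookup s ∘ h)

module _ {V : Set} {b : ℕ} where
  open Setoid (Names V b) using (_≈_)

  -- Since `ι` is injective, the subset at index `k` can be read off as the suffixes that occur with
  -- `ι k`.
  interpret-injective : ∀ {n} {ι : Fin n → V} → Injective _≡_ _≡_ ι →
    Injective {A = FinName n b} _≡_ _≈_ (interpret ι)
  interpret-injective {ι = ι} inj {s} {t} (s⊆t , t⊆s) = begin
    s                          ≡⟨ Vec.tabulate∘lookup s ⟨
    Vec.tabulate (Vec.lookup s) ≡⟨ Vec.tabulate-cong (λ k →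
                                     ⊆-antisym (sub s t k s⊆t) (sub t s k t⊆s)) ⟩
    Vec.tabulate (Vec.lookup t) ≡⟨ Vec.tabulate∘lookup t ⟩
    t                          ∎
    where
    open ≡-Reasoning
    sub : ∀ (s t : FinName _ b) k → (∀ {x} → interpret ι s x → interpret ι t x) →
          ∀ {i} → i ∈ₛ Vec.lookup s k → i ∈ₛ Vec.lookup t k
    sub s t k s⊆t i∈ with s⊆t (_ , refl , i∈)
    ... | _ , eq , i∈′ with inj eq
    ... | refl = i∈′

  -- Makes values of the rule recorded over two index sets comparable over one set of labels.
  interpret-move : ∀ {m n} {ι : Fin n → V} {κ : Fin m → V} {g h} →
    (∀ x → h (g x) ≡ x) → (∀ y → g (h y) ≡ y) → κ ≗ ι ∘ g →
    ∀ (s : FinName m b) → interpret κ s ≈ interpret ι (move h s)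
  interpret-move {ι = ι} {g = g} {h} hg gh eq s =
      (λ { {_ , i} (k , v≡ , i∈) → g k , trans v≡ (eq k) ,
           subst (i ∈ₛ_)
             (sym (trans (Vec.lookup∘tabulate _ (g k)) (cong (Vec.lookup s) (hg k)))) i∈ })
    , (λ { {_ , i} (k , v≡ , i∈) → h k , trans v≡ (trans (cong ι (sym (gh k))) (sym (eq (h k)))) ,
           subst (i ∈ₛ_) (Vec.lookup∘tabulate _ k) i∈ })

  interpret-rename : ∀ {n} (R : V ↔ V) {ι κ : Fin n → V} → Inverse.to R ∘ ι ≗ κ →
    ∀ (s : FinName n b) → Inverse.to (R *) (interpret ι s) ≈ interpret κ s
  interpret-rename R {ι} {κ} eq s =
      (λ { {v , _} (k , v≡ , i∈) →
           k , trans (sym (strictlyInverseˡ v)) (trans (cong to v≡) (eq k)) , i∈ })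
    , (λ { {v , _} (k , v≡ , i∈) →
           k , trans (cong from (trans v≡ (sym (eq k)))) (strictlyInverseʳ (ι k)) , i∈ })
    where open Inverse R

-- Table entries and the disks they locate.

module _ {b : ℕ} (e : Entry b) where
  open Entry e

  diskGraph : FiniteGraph (Fin size)
  diskGraph = symmetrised (allFin size) diskEdges

  valueGraph : FiniteGraph (FinName size b)
  valueGraph = symmetrised valueVertices valueEdges

  -- Concerns the disk only, which may be any copy of the representative; the value on it follows by
  -- `describes-value`.
  record Locates {V : Set} {r : ℕ} (ι : Fin size → V) (D : Disk V r) : Set where
    field
      injective : Injective _≡_ _≡_ ι
      centre≡   : centre D ≡ ι diskCentre
      describes : Describes ι diskGraph (graph D)

open Entry
open Locates

-- The decidable test on tables.

module _ (σ : Port ↔ Port) (n : ℕ) (periodic : Period σ n) where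

  -- Read through `g`, the disk of `e′` is that of `e` rotated at `k`. The inverse `h` is part of
  -- the data because `move` needs it, and the last component is an instance of `Reachable`.
  Matches : ∀ {b} (e e′ : Entry b) → Fin (size e) →
    (Fin (size e′) → Fin (size e)) → (Fin (size e) → Fin (size e′)) → Set
  Matches e e′ k g h =
      (∀ x → h (g x) ≡ x) × (∀ y → g (h y) ≡ y)
    × g (diskCentre e′) ≡ diskCentre e
    × relabel g (diskGraph e′) ≋ rotatesF Fin._≟_ σ (k ∷ []) (diskGraph e)
    × Any (λ ws → relabel (move h) (valueGraph e′) ≋ rotatesF _≟ⁿ_ σ ws (valueGraph e))
          (reduced _≟ⁿ_ σ n periodic (valueVertices e))

  matches? : ∀ {b} (e e′ : Entry b) k g h → Dec (Matches e e′ k g h)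
  matches? e e′ k g h =
    Fin.all? (λ x → h (g x) Fin.≟ x) ×-dec Fin.all? (λ y → g (h y) Fin.≟ y)
    ×-dec g (diskCentre e′) Fin.≟ diskCentre e
    ×-dec ≋-dec Fin._≟_ _ _
    ×-dec any? (λ ws → ≋-dec _≟ⁿ_ _ _) _

  -- Maps between index sets are coded by numbers, so every quantifier ranges over a `Fin` and the
  -- search is finite.
  Commutes : ∀ {b} → Table b → Set
  Commutes T = ∀ i (k : Fin (size (lookup T i))) → ∃[ j ]
    Σ[ g ∈ Fin (size (lookup T i) ^ size (lookup T j)) ]
    Σ[ h ∈ Fin (size (lookup T j) ^ size (lookup T i)) ]
      Matches (lookup T i) (lookup T j) k (finToFun g) (finToFun h)

  commutes? : ∀ {b} (T : Table b) → Dec (Commutes T)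
  commutes? T = Fin.all? λ i → Fin.all? λ k → Fin.any? λ j → Fin.any? λ g → Fin.any? λ h →
    matches? (lookup T i) (lookup T j) k (finToFun g) (finToFun h)

  -- Correctness of the test.

  module _ (em : ExcludedMiddle (lsuc 0ℓ)) {V : Set} {r b : ℕ} (f : LocalRule V r b)
           (T : Table b) (presents : Presents T f) where

    open Presents presents

    private
      infix 4 _≟_
      _≟_ : DecidableEquality V
      _≟_ = ≟-classical em

      turnDisk : V → Disk V r → Disk V r
      turnDisk u = rotateDisk _≟_ σ u

    locate-representative : ∀ i → ∃[ ι ]
      Locates (lookup T i) ι (representative i) ×
      Describes (interpret ι) (valueGraph (lookup T i)) (apply f (representative i))
    locate-representative i with records i
    ... | ι , c≡ , disk , value = Injection.to ι , record
      { injective = Injection.injective ι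
      ; centre≡   = c≡
      ; describes = lists⇒describes disk
      } , lists⇒describes value

    locate : ∀ D → ∃[ i ] ∃[ ι ] Locates (lookup T i) ι D
    locate D with complete D
    ... | i , (R , D≈ , c≡) , _ with locate-representative i
    ... | ι , loc , _ = i , Inverse.to R ∘ ι , record
      { injective = loc .injective ∘ Injection.injective (↔⇒↣ R)
      ; centre≡   = trans (sym c≡) (cong (Inverse.to R) (loc .centre≡))
      ; describes = describes-resp-≈ᴳ {G = rename R (graph (representative i))} {graph D} D≈
                      (describes-rename R (loc .describes))
      }

    -- The embeddings of the representative and of `D` differ by a permutation of `V`. It carries
    -- one disk to the other, and equivariance carries the recorded value along.
    describes-value : ∀ i {κ D} → Locates (lookup T i) κ D →
      Describes (interpret κ) (valueGraph (lookup T i)) (apply f D)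
    describes-value i {κ} {D} loc′ with locate-representative i
    ... | ι , loc , value with extend-to-bijection _≟_ (loc .injective) (loc′ .injective)
    ... | R , eq = describes-resp-≈ᴳ {G = rename (R *) (apply f D₀)} {apply f D}
      (≈ᴳ-trans {G = rename (R *) (apply f D₀)} {apply f (renameDisk R D₀)} {apply f D}
        (≈ᴳ-sym {G = apply f (renameDisk R D₀)} {rename (R *) (apply f D₀)}
          (LocalRule.equivariant f D₀ R))
        (Func.cong (LocalRule.func f) {renameDisk R D₀} {D}
          ( describes-unique {G = rename R (graph D₀)} {graph D}
              (describes-resp-names eq (describes-rename R (loc .describes))) (loc′ .describes)
          , trans (cong (Inverse.to R) (loc .centre≡)) (trans (eq _) (sym (loc′ .centre≡))))))
      (describes-resp-names (interpret-rename R eq) (describes-rename (R *) value))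
      where D₀ = representative i

    -- Both vertex sets are those of D, so two locations differ by a bijection of indices.
    vertex-map : ∀ {e e′ : Entry b} {ι κ D u} → Locates e ι D → Locates e′ κ (turnDisk u D) →
      (∀ x → ∃[ y ] κ x ≡ ι y) × (∀ y → ∃[ x ] ι y ≡ κ x)
    vertex-map loc loc′ =
        (λ x → map₂ proj₂ (loc .describes .vertex⁻ (loc′ .describes .vertex⁺ (∈-allFin x))))
      , (λ y → map₂ proj₂ (loc′ .describes .vertex⁻ (loc .describes .vertex⁺ (∈-allFin y))))

    -- Quantified over all disks, not just representatives, so that it applies again to a disk
    -- already rotated.
    SingleCommuting : Set₁
    SingleCommuting = ∀ D u → Vertex (graph D) u →
      Rotated σ (apply f D) (apply f (turnDisk u D))

    turned-describes : ∀ {e : Entry b} {ι D} k → Locates e ι D →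
      Describes ι (rotatesF Fin._≟_ σ (k ∷ []) (diskGraph e)) (graph (turnDisk (ι k) D))
    turned-describes {e} {ι} k loc =
      describes-rotates Fin._≟_ σ (loc .injective) {ws = k ∷ []} (loc .describes)

    -- The entry `j` is that of the isomorphism class of the rotated representative; the index maps
    -- come from comparing the two embeddings.
    single⇒commutes : SingleCommuting → Commutes T
    single⇒commutes single i k with locate-representative i
    ... | ι , loc , value with locate (turnDisk (ι k) (representative i))
    ... | j , κ , loc′ = j , funToFin g₀ , funToFin h₀ , hg , gh , centreᵍ≡ , disk , values
      where
      D  = representative i
      D′ = turnDisk (ι k) D
      maps = vertex-map {D = D} {u = ι k} loc loc′
      g₀ = proj₁ ∘ proj₁ maps
      h₀ = proj₁ ∘ proj₂ maps
      -- Encoding and decoding returns `g₀` only pointwise, so the rest is proved for the decoded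
      -- maps, which `Commutes` mentions.
      g : Fin (size (lookup T j)) → Fin (size (lookup T i))
      g = finToFun (funToFin g₀)
      h : Fin (size (lookup T i)) → Fin (size (lookup T j))
      h = finToFun (funToFin h₀)
      κ≡ : κ ≗ ι ∘ g
      κ≡ x = trans (proj₂ (proj₁ maps x)) (cong ι (sym (Fin.finToFun-funToFin g₀ x)))
      ι≡ : ι ≗ κ ∘ h
      ι≡ y = trans (proj₂ (proj₂ maps y)) (cong κ (sym (Fin.finToFun-funToFin h₀ y)))
      hg : ∀ x → h (g x) ≡ x
      hg x = loc′ .injective (trans (sym (ι≡ (g x))) (sym (κ≡ x)))
      gh : ∀ y → g (h y) ≡ y
      gh y = loc .injective (trans (sym (κ≡ (h y))) (sym (ι≡ y)))
      centreᵍ≡ : g (diskCentre (lookup T j)) ≡ diskCentre (lookup T i)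
      centreᵍ≡ = loc .injective (trans (sym (κ≡ _)) (trans (sym (loc′ .centre≡)) (loc .centre≡)))
      disk : relabel g (diskGraph (lookup T j)) ≋
             rotatesF Fin._≟_ σ (k ∷ []) (diskGraph (lookup T i))
      disk = describes-≋ (loc .injective)
        (describes-relabel g (describes-resp-names κ≡ (loc′ .describes)))
        (turned-describes {D = D} k loc)
      values : Any (λ ws → relabel (move h) (valueGraph (lookup T j)) ≋
                           rotatesF _≟ⁿ_ σ ws (valueGraph (lookup T i)))
                   (reduced _≟ⁿ_ σ n periodic (valueVertices (lookup T i)))
      values with single D (ι k) (loc .describes .vertex⁺ (∈-allFin k))
      ... | ws , ws∈ , eq = reachable⁺ _≟ⁿ_ σ (interpret-injective (loc .injective)) n periodic
        value (describes-relabel (move h) (describes-resp-names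
          (interpret-move {ι = ι} {κ} {g} {h} hg gh κ≡) (describes-value j {D = D′} loc′)))
        ws∈ eq

    -- The match makes `ι ∘ g` a location of entry `j` in the rotated disk, so both values are known
    -- over the indices of entry `i` and `reachable⁻` compares them.
    commutes⇒single : Commutes T → SingleCommuting
    commutes⇒single commutes D u u∈ with locate D
    ... | i , ι , loc with loc .describes .vertex⁻ u∈
    ... | k , _ , refl with commutes i k
    ... | j , g′ , h′ , hg , gh , centreᵍ≡ , disk , values =
      reachable⁻ _≟ⁿ_ σ (interpret-injective (loc .injective)) n periodic
        (describes-value i {D = D} loc)
        (describes-relabel (move h) (describes-resp-names
          (interpret-move {ι = ι} {ι ∘ g} {g} {h} hg gh (λ _ → refl))
          (describes-value j {D = turnDisk (ι k) D} loc′)))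
        values
      where
      g = finToFun g′
      h = finToFun h′
      loc′ : Locates (lookup T j) (ι ∘ g) (turnDisk (ι k) D)
      loc′ = record
        { injective = λ {x} {y} eq →
            trans (sym (hg x)) (trans (cong h (loc .injective eq)) (hg y))
        ; centre≡   = trans (loc .centre≡) (cong ι (sym centreᵍ≡))
        ; describes = describes-relabel⁻ g (describes-resp-≋
            (let (v⁺ , v⁻) , (e⁺ , e⁻) = disk in (v⁻ , v⁺) , (e⁻ , e⁺))
            (turned-describes {D = D} k loc))
        }

    -- From single rotations to rotation sequences.

    -- Stated for an abstract rotation so that proofs of r_u D being a disk need not be compared.
    rotated-foldr : ∀ (rot : V → Disk V r → Disk V r) →
      (∀ u D {v} → Vertex (graph D) v → Vertex (graph (rot u D)) v) →
      (∀ D u → Vertex (graph D) u → Rotated σ (apply f D) (apply f (rot u D))) →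
      ∀ D us → All (Vertex (graph D)) us → Rotated σ (apply f D) (apply f (foldr rot D us))
    rotated-foldr rot vertex single D []       []         = [] , [] , ≈ᴳ-refl {G = apply f D}
    rotated-foldr rot vertex single D (u ∷ us) (u∈ ∷ us∈) =
      rotated-trans σ {apply f D} {apply f D′} {apply f (rot u D′)}
        (rotated-foldr rot vertex single D us us∈) (single D′ u (vertices us u∈))
      where
      D′ = foldr rot D us
      vertices : ∀ us {v} → Vertex (graph D) v → Vertex (graph (foldr rot D us)) v
      vertices []       v∈ = v∈
      vertices (w ∷ us) v∈ = vertex w _ (vertices us v∈)

    single⇒rotationCommuting : SingleCommuting → RotationCommuting em σ f
    single⇒rotationCommuting =
      rotated-foldr (λ u → rotateDisk (≟-classical em) σ u) (λ _ _ v∈ → v∈)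

    rotationCommuting⇒single : RotationCommuting em σ f → SingleCommuting
    rotationCommuting⇒single commuting D u u∈ = commuting D (u ∷ []) (u∈ ∷ [])

proposition1 : (σ : Port ↔ Port) → Cyclic σ →
    Σ[ decide ∈ ((r b : ℕ) → Table b → Bool) ]
    ((em : ExcludedMiddle (lsuc 0ℓ)) (V : Set) → ¬ AtMostCountable (setoid V) →
    (r b : ℕ) (f : LocalRule V r b) (T : Table b) → Presents T f →
    (decide r b T ≡ true ⇔ RotationCommuting em σ f))
proposition1 σ cyclic with cyclic⇒periodic σ cyclic
... | n , periodic =
    -- The Boolean is computed from the table before `em` and `f` are introduced, so the procedure
    -- is constructive.
    (λ r b T → ⌊ commutes? σ n periodic T ⌋)
  , λ em V _ r b f T presents → mk⇔
      (λ eq → single⇒rotationCommuting σ n periodic em f T presents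
        (commutes⇒single σ n periodic em f T presents
          (toWitness {a? = commutes? σ n periodic T} (Equivalence.from T-≡ eq))))
      (λ commuting → Equivalence.to T-≡ (fromWitness {a? = commutes? σ n periodic T}
        (single⇒commutes σ n periodic em f T presents
          (rotationCommuting⇒single σ n periodic em f T presents commuting))))
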